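{- Let $n,k\ge 2$ be integers. (1) If $\mathrm{rad}(n)\nmid \mathrm{rad}(k)$, then $\mathsf{D}^*(n,nk)=\eta^*(n,nk)=\infty$. (2) If $\mathrm{rad}(n)\mid \mathrm{rad}(k)$, then $\mathsf{D}^*(n,nk)=\eta^*(n,nk)=2n-1$.
   Context: For a positive integer $n$, $\mathrm{rad}(n)=\prod_{p\mid n}p$ is the product of the distinct prime divisors of $n$, with $\mathrm{rad}(1)=1$. For integers $n,k\ge 2$: - $\mathsf{D}^*(n,nk)$ is the smallest positive integer $\ell$ such that, from any given $\ell$ integers (repetitions allowed) none of which is divisible by $n$, one can select some of them (a non-empty sub-multiset) whose sum is divisible by $n$ but not by $nk$; if no such $\ell$ exists, $\mathsf{D}^*(n,nk)=\infty$. - $\eta^*(n,nk)$ is the smallest positive integer $\ell$ such that, from any given $\ell$ integers (repetitions allowed) none of which is divisible by $n$, one can select at most $n$ of them (and at least one) whose sum is divisible by $n$ but not by $nk$; if no such $\ell$ exists, $\eta^*(n,nk)=\infty$. -}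

module Defs where

open import Data.Integer as ℤ using (ℤ; +_; 0ℤ)
open import Data.Integer.Divisibility as ℤ using ()
open import Data.List using (List; []; filter; foldr; length; upTo)
open import Data.List.Relation.Binary.Sublist.Propositional using (_⊆_)
open import Data.List.Relation.Unary.All using (All)
open import Data.Nat using (ℕ; suc; _≤_)
open import Data.Nat.Divisibility using (_∣?_)
open import Data.Nat.ListAction using (product)
open import Data.Nat.Primality using (prime?)
open import Data.Nat.Properties using (≤-antisym)
open import Data.Product using (_×_; _,_; ∃-syntax)
open import Relation.Binary.PropositionalEquality using (_≡_; _≢_; refl; cong)
open import Relation.Nullary using (¬_; contradiction)
open import Relation.Nullary.Decidable using (_×-dec_)
open import Relation.Nullary.Construct.Add.Supremum using (_⁺; [_]; ⊤⁺)

-- The prime divisors of n ≥ 1 all lie in 0, 1, …, n.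
rad : ℕ → ℕ
rad n = product (filter (λ p → prime? p ×-dec (p ∣? n)) (upTo (suc n)))

sumℤ : List ℤ → ℤ
sumℤ = foldr ℤ._+_ 0ℤ

ℕ∞ : Set
ℕ∞ = ℕ ⁺

pattern ∞ = ⊤⁺

-- "v is the smallest positive integer satisfying P, or ∞ if there is none".
-- A relation rather than a function: computing v would require deciding
-- whether some ℓ satisfies P.
IsLeastPositive : (ℕ → Set) → ℕ∞ → Set
IsLeastPositive P [ ℓ ] = 1 ≤ ℓ × P ℓ × (∀ m → 1 ≤ m → P m → ℓ ≤ m)
IsLeastPositive P ∞     = ∀ m → 1 ≤ m → ¬ P m

IsLeastPositive-unique : ∀ {P} v w →
  IsLeastPositive P v → IsLeastPositive P w → v ≡ w
IsLeastPositive-unique [ v ] [ w ] (1≤v , Pv , v≤) (1≤w , Pw , w≤) =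
  cong [_] (≤-antisym (v≤ w 1≤w Pw) (w≤ v 1≤v Pv))
IsLeastPositive-unique [ v ] ∞ (1≤v , Pv , _) ¬P = contradiction Pv (¬P v 1≤v)
IsLeastPositive-unique ∞ [ w ] ¬P (1≤w , Pw , _) = contradiction Pw (¬P w 1≤w)
IsLeastPositive-unique ∞ ∞ _ _ = refl

-- Finite multisets of integers are represented by lists.  _⊆_ is the sublist
-- relation, i.e. a choice of positions, so ys ranges over the sub-multisets
-- of xs with multiplicity respected.

D*-property : ℕ → ℕ → ℕ → Set
D*-property n m ℓ =
  ∀ (xs : List ℤ) → length xs ≡ ℓ → All (λ x → ¬ (+ n ℤ.∣ x)) xs →
  ∃[ ys ] (ys ⊆ xs × ys ≢ [] × (+ n ℤ.∣ sumℤ ys) × ¬ (+ m ℤ.∣ sumℤ ys))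

η*-property : ℕ → ℕ → ℕ → Set
η*-property n m ℓ =
  ∀ (xs : List ℤ) → length xs ≡ ℓ → All (λ x → ¬ (+ n ℤ.∣ x)) xs →
  ∃[ ys ] (ys ⊆ xs × ys ≢ [] × length ys ≤ n
           × (+ n ℤ.∣ sumℤ ys) × ¬ (+ m ℤ.∣ sumℤ ys))

-- D*⟨ n , m ⟩≔ v and η*⟨ n , m ⟩≔ v say that the invariant of (n , m), with m
-- a multiple of n, has the value v.
D*⟨_,_⟩≔_ : ℕ → ℕ → ℕ∞ → Set
D*⟨ n , m ⟩≔ v = IsLeastPositive (D*-property n m) v

η*⟨_,_⟩≔_ : ℕ → ℕ → ℕ∞ → Set
η*⟨ n , m ⟩≔ v = IsLeastPositive (η*-property n m) v

{-# OPTIONS --safe #-}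
-- For the upper bound, suppose that every sub-multiset of xs whose sum is divisible by n has
-- sum divisible by nk.  Two sets L and M of residues modulo n, initially {0}, are grown along
-- xs: an element z is added to L or to M as a + z, whenever this gives a new residue.  As
-- |L| + |M| ≤ 2n, some z among 2n − 1 elements leaves both sets stable under translation
-- by z.  Then L contains lifts aⱼ of all multiples jz, M contains lifts of their negatives, and
-- comparing sums shows aⱼ ≡ jz modulo nk.  Hence n ∣ jz implies nk ∣ jz for all j, which
-- forces n ∣ z when every prime divisor of n divides k.  The bound on the number of summands
-- comes for free: more than n summands contain a proper block with sum divisible by n.
module Submission where

open import Defs
open import Data.Fin as Fin using (Fin; toℕ; fromℕ<)
open import Data.Fin.Properties using (pigeonhole; toℕ<n; toℕ-fromℕ<)
open import Data.Integer as ℤ using (ℤ; +_; 0ℤ; 1ℤ; -1ℤ)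
import Data.Integer.Divisibility as ℤᵘ
open import Data.Integer.Divisibility.Signed as ℤˢ using (∣ᵤ⇒∣; ∣⇒∣ᵤ)
  renaming (_∣_ to _∣ℤ_; _∣?_ to _∣ℤ?_)
open import Data.Integer.DivMod using (_%ℕ_; _/ℕ_; n%ℕd<d; a≡a%ℕn+[a/ℕn]*n)
import Data.Integer.Properties as ℤₚ
open import Data.Integer.Tactic.RingSolver using (solve-∀)
open import Data.List
  using (List; []; _∷_; _++_; length; lookup; replicate; take; drop; filter; upTo)
open import Data.List.Properties
  using (++-identityʳ; length-++; length-take; length-drop; length-replicate; take++drop≡id; drop-drop)
open import Data.List.Membership.Propositional using (_∈_; find)
open import Data.List.Membership.Propositional.Properties using (∈-filter⁺; ∈-filter⁻; ∈-lookup; ∈-upTo⁺)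
open import Data.List.Relation.Binary.Sublist.Propositional
  using (_⊆_; []; _∷_; _∷ʳ_; minimum; ⊆-refl; ⊆-trans)
open import Data.List.Relation.Binary.Sublist.Propositional.Properties using (++⁺; ++⁺ˡ)
open import Data.List.Relation.Unary.All as All using (All; []; _∷_; all?)
open import Data.List.Relation.Unary.All.Properties using (¬All⇒Any¬; ¬Any⇒All¬; replicate⁺)
  renaming (++⁺ to All-++⁺)
open import Data.List.Relation.Unary.AllPairs using (AllPairs; []; _∷_)
open import Data.List.Relation.Unary.Any using (Any; here; there; any?)
open import Data.List.Relation.Unary.Unique.Propositional using (Unique)
import Data.List.Relation.Unary.Unique.Propositional.Properties as Unique
open import Data.Nat
  using (ℕ; zero; suc; _+_; _≤_; _<_; _*_; _∸_; _⊓_; _⊔_; NonZero; z≤n; s≤s; s≤s⁻¹; _≤?_; >-nonZero)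
open import Data.Nat.Divisibility
  using (_∣_; _∣?_; divides; ∣-trans; ∣-refl; _∣0; ∣⇒≤; >⇒∤; m∣m*n; n∣m*n; *-monoʳ-∣; *-monoˡ-∣; *-cancelˡ-∣; 1∣_)
open import Data.Nat.ListAction using (product)
open import Data.Nat.ListAction.Properties using (∈⇒∣product)
open import Data.Nat.Primality using (Prime; prime?; euclidsLemma; prime⇒nonZero)
open import Data.Nat.Primality.Factorisation
  using (factorise; factorisationHasAllPrimeFactors; module PrimeFactorisation)
open import Data.Nat.Properties
open import Data.Product using (_×_; _,_; ∃-syntax; ∃₂; proj₁; proj₂)
open import Data.Sum using (inj₁; inj₂)
open import Function using (_∘_)
open import Relation.Binary.PropositionalEquality
  using (_≡_; refl; sym; trans; cong; cong₂; subst; subst₂; module ≡-Reasoning)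
open import Relation.Nullary using (¬_; Dec; yes; no; contradiction)
open import Relation.Nullary.Construct.Add.Supremum using ([_])
open import Relation.Nullary.Decidable using (_×-dec_; ¬?; map′; decidable-stable)

-- Sublists and their sums

AllPairs-lookup : ∀ {A : Set} {R : A → A → Set} {xs} → AllPairs R xs →
  ∀ {i j} → i Fin.< j → R (lookup xs i) (lookup xs j)
AllPairs-lookup (Rx ∷ _)  {Fin.zero}  {Fin.suc j} _         = All.lookup Rx (∈-lookup j)
AllPairs-lookup (_ ∷ Rs) {Fin.suc i} {Fin.suc j} (s≤s i<j) = AllPairs-lookup Rs i<j

-- Makes the indirect argument for the upper bound constructive: either a suitable sublist is found,
-- or there is provably none.
dec-∃-⊆ : ∀ {A : Set} {P : List A → Set} → (∀ ys → Dec (P ys)) →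
  ∀ xs → Dec (∃[ ys ] (ys ⊆ xs × P ys))
dec-∃-⊆ P? [] = map′ (λ p → [] , [] , p) (λ { ([] , [] , p) → p }) (P? [])
dec-∃-⊆ P? (x ∷ xs) with dec-∃-⊆ P? xs | dec-∃-⊆ (P? ∘ (x ∷_)) xs
... | yes (ys , ys⊆xs , p) | _ = yes (ys , x ∷ʳ ys⊆xs , p)
... | no _ | yes (ys , ys⊆xs , p) = yes (x ∷ ys , refl ∷ ys⊆xs , p)
... | no ¬without | no ¬with = no λ where
  (ys , _ ∷ʳ ys⊆xs , p)        → ¬without (ys , ys⊆xs , p)
  (_ ∷ ys , refl ∷ ys⊆xs , p) → ¬with (ys , ys⊆xs , p)

sumℤ-++ : ∀ xs ys → sumℤ (xs ++ ys) ≡ sumℤ xs ℤ.+ sumℤ ys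
sumℤ-++ []       ys = sym (ℤₚ.+-identityˡ _)
sumℤ-++ (x ∷ xs) ys = trans (cong (ℤ._+_ x) (sumℤ-++ xs ys)) (sym (ℤₚ.+-assoc x _ _))

-- Both extremal sequences consist of blocks of equal terms, so a subsum depends only on how many
-- terms it takes from each block. The tail `zs` lets blocks be peeled off in turn; the sequences
-- end in `++ []` so that this also covers the last block.
⊆-replicate-++ : ∀ i x zs {ys} → ys ⊆ replicate i x ++ zs →
  ∃₂ λ a ws → a ≤ i × ws ⊆ zs × sumℤ ys ≡ + a ℤ.* x ℤ.+ sumℤ ws
⊆-replicate-++ zero x zs {ys} ys⊆zs = 0 , ys , z≤n , ys⊆zs , sym (ℤₚ.+-identityˡ _)
⊆-replicate-++ (suc i) x zs (_ ∷ʳ ys⊆) =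
  let a , ws , a≤i , ws⊆zs , eq = ⊆-replicate-++ i x zs ys⊆
  in  a , ws , m≤n⇒m≤1+n a≤i , ws⊆zs , eq
⊆-replicate-++ (suc i) x zs (refl ∷ ys⊆) =
  let a , ws , a≤i , ws⊆zs , eq = ⊆-replicate-++ i x zs ys⊆
  in  suc a , ws , s≤s a≤i , ws⊆zs , trans (cong (ℤ._+_ x) eq) (regroup x (+ a) (sumℤ ws))
  where
  regroup : ∀ x a s → x ℤ.+ (a ℤ.* x ℤ.+ s) ≡ (1ℤ ℤ.+ a) ℤ.* x ℤ.+ s
  regroup = solve-∀

-- The radical

primeDivisors : ℕ → List ℕ
primeDivisors n = filter (λ p → prime? p ×-dec (p ∣? n)) (upTo (suc n))

∈-primeDivisors⁻ : ∀ {p} n → p ∈ primeDivisors n → Prime p × p ∣ n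
∈-primeDivisors⁻ n p∈ = proj₂ (∈-filter⁻ (λ p → prime? p ×-dec (p ∣? n)) {xs = upTo (suc n)} p∈)

prime∣rad : ∀ {p n} .{{_ : NonZero n}} → Prime p → p ∣ n → p ∣ rad n
prime∣rad {p} {n} p-prime p∣n =
  ∈⇒∣product (∈-filter⁺ (λ p → prime? p ×-dec (p ∣? n)) (∈-upTo⁺ (s≤s (∣⇒≤ p∣n))) (p-prime , p∣n))

prime∣rad⇒∣ : ∀ {p} n → Prime p → p ∣ rad n → p ∣ n
prime∣rad⇒∣ n p-prime p∣rad = proj₂ (∈-primeDivisors⁻ n
  (factorisationHasAllPrimeFactors p-prime p∣rad (All.tabulate (proj₁ ∘ ∈-primeDivisors⁻ n))))

-- By induction m = q · `product ps`. The next prime p divides one of the two factors; if it divided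
-- the product, it would be a member of `ps`, against distinctness.
product-distinctPrimes-∣ : ∀ {ps m} → Unique ps → All Prime ps → All (_∣ m) ps → product ps ∣ m
product-distinctPrimes-∣ [] [] [] = 1∣ _
product-distinctPrimes-∣ {p ∷ ps} (p∉ps ∷ ps!) (p-prime ∷ primes) (p∣m ∷ ps∣m)
  with product-distinctPrimes-∣ ps! primes ps∣m
... | divides q refl with euclidsLemma q (product ps) p-prime p∣m
... | inj₁ p∣q = *-monoˡ-∣ (product ps) p∣q
... | inj₂ p∣Π = contradiction refl
  (All.lookup p∉ps (factorisationHasAllPrimeFactors p-prime p∣Π primes))

rad∣rad : ∀ n k .{{_ : NonZero k}} → All (_∣ k) (primeDivisors n) → rad n ∣ rad k
rad∣rad n k ps∣k = product-distinctPrimes-∣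
  (Unique.filter⁺ (λ p → prime? p ×-dec (p ∣? n)) (Unique.upTo⁺ (suc n)))
  (All.tabulate (proj₁ ∘ ∈-primeDivisors⁻ n))
  (All.tabulate λ p∈ → prime∣rad (proj₁ (∈-primeDivisors⁻ n p∈)) (All.lookup ps∣k p∈))

-- The prime comes from a search through the finite list `primeDivisors n`: if all its members
-- divided k, then `rad n` would divide `rad k`.
rad∤rad⇒prime : ∀ n k .{{_ : NonZero k}} → ¬ rad n ∣ rad k → ∃[ p ] (Prime p × p ∣ n × ¬ p ∣ k)
rad∤rad⇒prime n k rad∤ =
  let p , p∈ , p∤k = find (¬All⇒Any¬ (_∣? k) (primeDivisors n) (rad∤ ∘ rad∣rad n k))
      p-prime , p∣n = ∈-primeDivisors⁻ n p∈
  in  p , p-prime , p∣n , p∤k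

rad∣rad⇒prime∣ : ∀ {n k p} .{{_ : NonZero n}} → rad n ∣ rad k → Prime p → p ∣ n → p ∣ k
rad∣rad⇒prime∣ {k = k} rad∣ p-prime p∣n =
  prime∣rad⇒∣ k p-prime (∣-trans (prime∣rad p-prime p∣n) rad∣)

-- Residues modulo n

≡%⇒∣- : ∀ n .{{_ : NonZero n}} a b → a %ℕ n ≡ b %ℕ n → + n ∣ℤ a ℤ.- b
≡%⇒∣- n a b eq = ℤˢ.divides (a /ℕ n ℤ.- b /ℕ n) (begin
  a ℤ.- b ≡⟨ cong₂ ℤ._-_ (a≡a%ℕn+[a/ℕn]*n a n) (a≡a%ℕn+[a/ℕn]*n b n) ⟩
  (+ (a %ℕ n) ℤ.+ a /ℕ n ℤ.* + n) ℤ.- (+ (b %ℕ n) ℤ.+ b /ℕ n ℤ.* + n)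
    ≡⟨ cong (λ r → (+ r ℤ.+ a /ℕ n ℤ.* + n) ℤ.- (+ (b %ℕ n) ℤ.+ b /ℕ n ℤ.* + n)) eq ⟩
  (+ (b %ℕ n) ℤ.+ a /ℕ n ℤ.* + n) ℤ.- (+ (b %ℕ n) ℤ.+ b /ℕ n ℤ.* + n)
    ≡⟨ cancel (+ (b %ℕ n)) (a /ℕ n) (b /ℕ n) (+ n) ⟩
  (a /ℕ n ℤ.- b /ℕ n) ℤ.* + n ∎)
  where
  open ≡-Reasoning
  cancel : ∀ r x y n → (r ℤ.+ x ℤ.* n) ℤ.- (r ℤ.+ y ℤ.* n) ≡ (x ℤ.- y) ℤ.* n
  cancel = solve-∀

pigeonhole-mod : ∀ {n m} .{{_ : NonZero n}} → n < m → (f : Fin m → ℤ) →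
  ∃₂ λ i j → i Fin.< j × + n ∣ℤ f i ℤ.- f j
pigeonhole-mod {n} n<m f =
  let residue i = fromℕ< (n%ℕd<d (f i) n)
      i , j , i<j , eq = pigeonhole n<m residue
      toℕ-residue i = toℕ-fromℕ< (n%ℕd<d (f i) n)
  in  i , j , i<j , ≡%⇒∣- n (f i) (f j)
        (trans (sym (toℕ-residue i)) (trans (cong toℕ eq) (toℕ-residue j)))

Incongruent : ℕ → List ℤ → Set
Incongruent n = AllPairs (λ a b → ¬ + n ∣ℤ a ℤ.- b)

incongruent⇒length≤ : ∀ {n L} .{{_ : NonZero n}} → Incongruent n L → length L ≤ n
incongruent⇒length≤ {n} {L} distinct with length L ≤? n
... | yes |L|≤n = |L|≤n
... | no  |L|≰n =
  let i , j , i<j , n∣ = pigeonhole-mod (≰⇒> |L|≰n) (lookup L)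
  in  contradiction n∣ (AllPairs-lookup distinct i<j)

-- Shortening zero-sum sublists

-- Among the sums of the suffixes starting at positions 0, ..., n two agree modulo n, and their
-- difference is the sum of the block in between.
zeroSumBlock : ∀ {n} .{{_ : NonZero n}} ys → n < length ys →
  ∃[ us ] ∃[ vs ] ∃[ ws ] (ys ≡ us ++ vs ++ ws × 0 < length vs × length vs ≤ n × + n ∣ℤ sumℤ vs)
zeroSumBlock {n} ys n<|ys| with pigeonhole-mod (n<1+n n) (λ i → sumℤ (drop (toℕ i) ys))
... | i′ , j′ , i<j , n∣ = us , vs , ws
  , sym (trans (cong (us ++_) (take++drop≡id d (drop i ys))) (take++drop≡id i ys))
  , subst (0 <_) (sym |vs|)
      (⊓-glb (m<n⇒0<n∸m i<j) (subst (0 <_) (sym (length-drop i ys)) (m<n⇒0<n∸m i<|ys|)))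
  , subst (_≤ n) (sym |vs|) (≤-trans (m⊓n≤m d _) (≤-trans (m∸n≤m j i) j≤n))
  , subst (+ n ∣ℤ_) block-sum n∣
  where
  i = toℕ i′
  j = toℕ j′
  d = j ∸ i
  us = take i ys
  vs = take d (drop i ys)
  ws = drop d (drop i ys)
  j≤n = s≤s⁻¹ (toℕ<n j′)
  i<|ys| = <-≤-trans i<j (≤-trans j≤n (<⇒≤ n<|ys|))
  |vs| = length-take d (drop i ys)
  block-sum : sumℤ (drop i ys) ℤ.- sumℤ (drop j ys) ≡ sumℤ vs
  block-sum = begin
    sumℤ (drop i ys) ℤ.- sumℤ (drop j ys)
      ≡⟨ cong₂ (λ xs zs → sumℤ xs ℤ.- sumℤ zs) (sym (take++drop≡id d (drop i ys)))
           (sym (trans (drop-drop i d ys) (cong (λ k → drop k ys) (m+[n∸m]≡n (<⇒≤ i<j))))) ⟩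
    sumℤ (vs ++ ws) ℤ.- sumℤ ws         ≡⟨ cong (ℤ._- sumℤ ws) (sumℤ-++ vs ws) ⟩
    (sumℤ vs ℤ.+ sumℤ ws) ℤ.- sumℤ ws   ≡⟨ cancel (sumℤ vs) (sumℤ ws) ⟩
    sumℤ vs ∎
    where
    open ≡-Reasoning
    cancel : ∀ x y → (x ℤ.+ y) ℤ.- y ≡ x
    cancel = solve-∀

-- Of a zero-sum block and the rest of the list, one has a sum not divisible by m.
shorten : ∀ {n m} .{{_ : NonZero n}} l ys → length ys ≤ l → + n ∣ℤ sumℤ ys → ¬ + m ∣ℤ sumℤ ys →
  ∃[ zs ] (zs ⊆ ys × length zs ≤ n × + n ∣ℤ sumℤ zs × ¬ + m ∣ℤ sumℤ zs)
shorten {n} {m} l ys |ys|≤l n∣ys m∤ys with length ys ≤? n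
... | yes |ys|≤n = ys , ⊆-refl , |ys|≤n , n∣ys , m∤ys
... | no  |ys|≰n with zeroSumBlock ys (≰⇒> |ys|≰n)
... | us , vs , ws , refl , 0<|vs| , |vs|≤n , n∣vs with + m ∣ℤ? sumℤ vs
... | no m∤vs = vs , ++⁺ˡ us vs⊆vs++ws , |vs|≤n , n∣vs , m∤vs
  where
  vs⊆vs++ws : vs ⊆ vs ++ ws
  vs⊆vs++ws = subst (_⊆ vs ++ ws) (++-identityʳ vs) (++⁺ (⊆-refl {x = vs}) (minimum ws))
... | yes m∣vs = recurse l |ys|≤l
  where
  split-sum : sumℤ (us ++ vs ++ ws) ≡ sumℤ (us ++ ws) ℤ.+ sumℤ vs
  split-sum = begin
    sumℤ (us ++ vs ++ ws)                 ≡⟨ sumℤ-++ us (vs ++ ws) ⟩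
    sumℤ us ℤ.+ sumℤ (vs ++ ws)           ≡⟨ cong (ℤ._+_ (sumℤ us)) (sumℤ-++ vs ws) ⟩
    sumℤ us ℤ.+ (sumℤ vs ℤ.+ sumℤ ws)     ≡⟨ swap (sumℤ us) (sumℤ vs) (sumℤ ws) ⟩
    (sumℤ us ℤ.+ sumℤ ws) ℤ.+ sumℤ vs     ≡⟨ cong (ℤ._+ sumℤ vs) (sumℤ-++ us ws) ⟨
    sumℤ (us ++ ws) ℤ.+ sumℤ vs ∎
    where
    open ≡-Reasoning
    swap : ∀ x y z → x ℤ.+ (y ℤ.+ z) ≡ (x ℤ.+ z) ℤ.+ y
    swap = solve-∀
  shorter : length (us ++ ws) < length (us ++ vs ++ ws)
  shorter rewrite length-++ us {ws} | length-++ us {vs ++ ws} | length-++ vs {ws} =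
    +-monoʳ-< (length us) (+-monoˡ-≤ (length ws) 0<|vs|)
  -- The bound `l` on the length makes the recursion structural; it decreases because the removed
  -- block `vs` is non-empty.
  recurse : ∀ l → length (us ++ vs ++ ws) ≤ l →
    ∃[ zs ] (zs ⊆ us ++ vs ++ ws × length zs ≤ n × + n ∣ℤ sumℤ zs × ¬ + m ∣ℤ sumℤ zs)
  recurse zero    |ys|≤0   = contradiction (≤-trans shorter |ys|≤0) λ ()
  recurse (suc l) |ys|≤1+l =
    let zs , zs⊆ , short , n∣zs , m∤zs = shorten l (us ++ ws) (s≤s⁻¹ (≤-trans shorter |ys|≤1+l))
          (ℤˢ.∣m+n∣n⇒∣m (subst (+ n ∣ℤ_) split-sum n∣ys) n∣vs)
          (λ m∣ → m∤ys (subst (+ m ∣ℤ_) (sym split-sum) (ℤˢ.∣m∣n⇒∣m+n m∣ m∣vs)))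
    in  zs , ⊆-trans zs⊆ (++⁺ (⊆-refl {x = us}) (++⁺ˡ vs ⊆-refl)) , short , n∣zs , m∤zs

-- Pairs of sumsets and stability under translation

ZeroSumClosed : ℕ → ℕ → List ℤ → Set
ZeroSumClosed n m xs = ∀ {ys} → ys ⊆ xs → + n ∣ℤ sumℤ ys → + m ∣ℤ sumℤ ys

-- L and M play the role of the sets of subset sums of two disjoint parts of xs.
record SumsetPair (n : ℕ) (xs L M : List ℤ) : Set where
  field
    distinctˡ : Incongruent n L
    distinctʳ : Incongruent n M
    0∈ˡ       : 0ℤ ∈ L
    0∈ʳ       : 0ℤ ∈ M
    realise   : ∀ {a b} → a ∈ L → b ∈ M → ∃[ ys ] (ys ⊆ xs × sumℤ ys ≡ a ℤ.+ b)

open SumsetPair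

sumsetPair-[] : ∀ {n} → SumsetPair n [] (0ℤ ∷ []) (0ℤ ∷ [])
sumsetPair-[] = record
  { distinctˡ = [] ∷ [] ; distinctʳ = [] ∷ [] ; 0∈ˡ = here refl ; 0∈ʳ = here refl
  ; realise = λ { (here refl) (here refl) → [] , [] , refl } }

sumsetPair-swap : ∀ {n xs L M} → SumsetPair n xs L M → SumsetPair n xs M L
sumsetPair-swap S = record
  { distinctˡ = distinctʳ S ; distinctʳ = distinctˡ S ; 0∈ˡ = 0∈ʳ S ; 0∈ʳ = 0∈ˡ S
  ; realise = λ {b} {a} b∈M a∈L →
      let ys , ys⊆xs , eq = realise S a∈L b∈M in ys , ys⊆xs , trans eq (ℤₚ.+-comm a b) }

-- Sums using the new residue spend z on top of a sublist of `xs` realising a + b. Only one residue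
-- of the translate L + z is added, so the size grows by exactly one.
sumsetPair-∷ : ∀ {n xs L M a z} → SumsetPair n xs L M → a ∈ L →
  All (λ a′ → ¬ + n ∣ℤ (a ℤ.+ z) ℤ.- a′) L → SumsetPair n (z ∷ xs) (a ℤ.+ z ∷ L) M
sumsetPair-∷ {a = a} {z} S a∈L new = record
  { distinctˡ = new ∷ distinctˡ S ; distinctʳ = distinctʳ S ; 0∈ˡ = there (0∈ˡ S) ; 0∈ʳ = 0∈ʳ S
  ; realise = λ where
      (here refl) b∈M → let ys , ys⊆xs , eq = realise S a∈L b∈M in
        z ∷ ys , refl ∷ ys⊆xs , trans (cong (ℤ._+_ z) eq) (rotate z a _)
      (there a′∈L) b∈M → let ys , ys⊆xs , eq = realise S a′∈L b∈M in ys , z ∷ʳ ys⊆xs , eq }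
  where
  rotate : ∀ z a b → z ℤ.+ (a ℤ.+ b) ≡ (a ℤ.+ z) ℤ.+ b
  rotate = solve-∀

Stable : ℕ → ℤ → List ℤ → Set
Stable n z L = All (λ a → Any (λ a′ → + n ∣ℤ (a ℤ.+ z) ℤ.- a′) L) L

stable? : ∀ n z L → Dec (Stable n z L)
stable? n z L = all? (λ a → any? (λ a′ → + n ∣ℤ? (a ℤ.+ z) ℤ.- a′) L) L

¬stable⇒new : ∀ {n z L} → ¬ Stable n z L →
  ∃[ a ] (a ∈ L × All (λ a′ → ¬ + n ∣ℤ (a ℤ.+ z) ℤ.- a′) L)
¬stable⇒new {n} {z} {L} ¬stable =
  let a , a∈L , ¬any = find (¬All⇒Any¬ (λ a → any? (λ a′ → + n ∣ℤ? (a ℤ.+ z) ℤ.- a′) L) L ¬stable)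
  in  a , a∈L , ¬Any⇒All¬ L ¬any

-- Starting from 0, each further multiple is reached by translating the previous representative by z
-- and moving back into L by stability.
stable⇒multiples : ∀ {n z L} → Stable n z L → 0ℤ ∈ L →
  ∀ j → ∃[ a ] (a ∈ L × + n ∣ℤ + j ℤ.* z ℤ.- a)
stable⇒multiples stable 0∈L zero = 0ℤ , 0∈L , ℤˢ.divides 0ℤ refl
stable⇒multiples {n} {z} stable 0∈L (suc j) =
  let a , a∈L , n∣    = stable⇒multiples stable 0∈L j
      a′ , a′∈L , n∣′ = find (All.lookup stable a∈L)
  in  a′ , a′∈L , subst (+ n ∣ℤ_) (telescope (+ j) z a a′) (ℤˢ.∣m∣n⇒∣m+n n∣ n∣′)
  where
  telescope : ∀ j z a a′ → (j ℤ.* z ℤ.- a) ℤ.+ ((a ℤ.+ z) ℤ.- a′) ≡ (1ℤ ℤ.+ j) ℤ.* z ℤ.- a′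
  telescope = solve-∀

-- −j ≡ (n − 1) j modulo n.
stable⇒negativeMultiples : ∀ {n z L} .{{_ : NonZero n}} → Stable n z L → 0ℤ ∈ L →
  ∀ j → ∃[ b ] (b ∈ L × + n ∣ℤ + j ℤ.* z ℤ.+ b)
stable⇒negativeMultiples {suc n} {z} stable 0∈L j =
  let b , b∈L , n∣ = stable⇒multiples stable 0∈L (n * j)
  in  b , b∈L , subst (+ suc n ∣ℤ_)
        (trans (cong (λ i → + suc n ℤ.* (+ j ℤ.* z) ℤ.- (i ℤ.* z ℤ.- b)) (ℤₚ.pos-* n j))
               (complement (+ n) (+ j) z b))
        (ℤˢ.∣m∣n⇒∣m-n (ℤˢ.∣m⇒∣m*n (+ j ℤ.* z) ℤˢ.∣-refl) n∣)
  where
  complement : ∀ n j z b → (1ℤ ℤ.+ n) ℤ.* (j ℤ.* z) ℤ.- ((n ℤ.* j) ℤ.* z ℤ.- b) ≡ j ℤ.* z ℤ.+ b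
  complement = solve-∀

-- Lifting congruences from n to m

module _ {n m xs z L M} .{{_ : NonZero n}}
  (closed : ZeroSumClosed n m (z ∷ xs)) (S : SumsetPair n xs L M)
  (stableˡ : Stable n z L) (stableʳ : Stable n z M) where

  private
    without-z : ∀ {a b} → a ∈ L → b ∈ M → + n ∣ℤ a ℤ.+ b → + m ∣ℤ a ℤ.+ b
    without-z a∈L b∈M n∣ =
      let ys , ys⊆xs , eq = realise S a∈L b∈M
      in  subst (+ m ∣ℤ_) eq (closed (z ∷ʳ ys⊆xs) (subst (+ n ∣ℤ_) (sym eq) n∣))

    -- L and M are built from `xs` alone, so z is still free to join any sublist realising a + b.
    with-z : ∀ {a b} → a ∈ L → b ∈ M → + n ∣ℤ z ℤ.+ (a ℤ.+ b) → + m ∣ℤ z ℤ.+ (a ℤ.+ b)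
    with-z a∈L b∈M n∣ =
      let ys , ys⊆xs , eq = realise S a∈L b∈M
          eq′ = cong (ℤ._+_ z) eq
      in  subst (+ m ∣ℤ_) eq′ (closed (refl ∷ ys⊆xs) (subst (+ n ∣ℤ_) (sym eq′) n∣))

  -- If b ∈ M is congruent to −(j + 1)z, then a + b and aⱼ + z + b are both zero modulo n,
  -- hence modulo m, so that a ≡ aⱼ + z modulo m.
  congruence-lifts : ∀ j {a} → a ∈ L → + n ∣ℤ + j ℤ.* z ℤ.- a → + m ∣ℤ + j ℤ.* z ℤ.- a
  congruence-lifts zero {a} a∈L n∣-a =
    subst (+ m ∣ℤ_) (neg z a) (ℤˢ.∣m⇒∣-m (without-z a∈L (0∈ʳ S)
      (subst (+ n ∣ℤ_) (neg′ z a) (ℤˢ.∣m⇒∣-m n∣-a))))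
    where
    neg : ∀ z a → ℤ.- (a ℤ.+ 0ℤ) ≡ 0ℤ ℤ.* z ℤ.- a
    neg = solve-∀
    neg′ : ∀ z a → ℤ.- (0ℤ ℤ.* z ℤ.- a) ≡ a ℤ.+ 0ℤ
    neg′ = solve-∀
  congruence-lifts (suc j) {a} a∈L n∣
    with aⱼ , aⱼ∈L , n∣ⱼ ← stable⇒multiples stableˡ (0∈ˡ S) j
       | b , b∈M , n∣b ← stable⇒negativeMultiples stableʳ (0∈ʳ S) (suc j)
    -- The first term is the induction hypothesis for `aⱼ`; then `aⱼ` and b cancel in (jz - aⱼ) + (z
    -- + aⱼ + b) - (a + b) = (j + 1)z - a.
    = subst (+ m ∣ℤ_) (combine (+ j) z a aⱼ b)
        (ℤˢ.∣m∣n⇒∣m-n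
          (ℤˢ.∣m∣n⇒∣m+n (congruence-lifts j aⱼ∈L n∣ⱼ)
            (with-z aⱼ∈L b∈M (subst (+ n ∣ℤ_) (diff-with-z (+ j) z aⱼ b) (ℤˢ.∣m∣n⇒∣m-n n∣b n∣ⱼ))))
          (without-z a∈L b∈M (subst (+ n ∣ℤ_) (diff (+ suc j ℤ.* z) a b) (ℤˢ.∣m∣n⇒∣m-n n∣b n∣))))
    where
    diff : ∀ x a b → (x ℤ.+ b) ℤ.- (x ℤ.- a) ≡ a ℤ.+ b
    diff = solve-∀
    diff-with-z : ∀ j z a b → ((1ℤ ℤ.+ j) ℤ.* z ℤ.+ b) ℤ.- (j ℤ.* z ℤ.- a) ≡ z ℤ.+ (a ℤ.+ b)
    diff-with-z = solve-∀
    combine : ∀ j z a a′ b →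
      ((j ℤ.* z ℤ.- a′) ℤ.+ (z ℤ.+ (a′ ℤ.+ b))) ℤ.- (a ℤ.+ b) ≡ (1ℤ ℤ.+ j) ℤ.* z ℤ.- a
    combine = solve-∀

  -- If n divides jz, then 0 ∈ L is itself a representative of jz.
  multiples-lift : ∀ j → + n ∣ℤ + j ℤ.* z → + m ∣ℤ + j ℤ.* z
  multiples-lift j n∣ = subst (+ m ∣ℤ_) (ℤₚ.+-identityʳ _)
    (congruence-lifts j (0∈ˡ S) (subst (+ n ∣ℤ_) (sym (ℤₚ.+-identityʳ _)) n∣))

-- Starting from n ∣ n z, the prime factors of the multiplier are cancelled one at a time:
-- n ∣ p e z gives n p ∣ n k ∣ p e z, hence n ∣ e z.
multiples-lift⇒∣ : ∀ {n k z} .{{_ : NonZero n}} → (∀ {p} → Prime p → p ∣ n → p ∣ k) →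
  (∀ j → + n ∣ℤ + j ℤ.* z → + (n * k) ∣ℤ + j ℤ.* z) → + n ∣ℤ z
multiples-lift⇒∣ {n} {k} {z} p∣n⇒p∣k lift =
  descend factors factorsPrime (subst (_∣ n) isFactorisation ∣-refl)
    (subst (λ d → + n ∣ℤ + d ℤ.* z) isFactorisation (ℤˢ.∣m⇒∣m*n z ℤˢ.∣-refl))
  where
  open PrimeFactorisation (factorise n)
  -- Carrying `product ps ∣ n` ensures that each cancelled prime divides n, and therefore k.
  descend : ∀ ps → All Prime ps → product ps ∣ n → + n ∣ℤ + product ps ℤ.* z → + n ∣ℤ z
  descend [] [] _ n∣ = subst (+ n ∣ℤ_) (ℤₚ.*-identityˡ z) n∣
  descend (p ∷ ps) (p-prime ∷ primes) Π∣n n∣ =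
    descend ps primes (∣-trans (n∣m*n p) Π∣n)
      (ℤˢ.*-cancelˡ-∣ (+ p) {{prime⇒nonZero p-prime}}
        (subst₂ _∣ℤ_ (ℤₚ.pos-* p n) pΠz≡ (ℤˢ.∣-trans (∣ᵤ⇒∣ pn∣nk) (lift (p * product ps) n∣))))
    where
    p∣k = p∣n⇒p∣k p-prime (∣-trans (m∣m*n (product ps)) Π∣n)
    pn∣nk : p * n ∣ n * k
    pn∣nk = subst (_∣ n * k) (*-comm n p) (*-monoʳ-∣ n p∣k)
    pΠz≡ : + (p * product ps) ℤ.* z ≡ + p ℤ.* (+ product ps ℤ.* z)
    pΠz≡ = trans (cong (ℤ._* z) (ℤₚ.pos-* p (product ps))) (ℤₚ.*-assoc (+ p) (+ product ps) z)

-- The upper bound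

module _ {n k} .{{_ : NonZero n}} (p∣n⇒p∣k : ∀ {p} → Prime p → p ∣ n → p ∣ k) where

  -- Each z enlarges one of the sets by one residue; otherwise both are stable under z, which forces
  -- n ∣ z. The 2 counts the initial zeros.
  largeSumsets : ∀ xs → All (λ x → ¬ + n ∣ℤ x) xs → ZeroSumClosed n (n * k) xs →
    ∃₂ λ L M → SumsetPair n xs L M × length L + length M ≡ 2 + length xs
  largeSumsets [] [] closed = (0ℤ ∷ []) , (0ℤ ∷ []) , sumsetPair-[] , refl
  largeSumsets (z ∷ xs) (n∤z ∷ n∤xs) closed
    with L , M , S , size ← largeSumsets xs n∤xs (closed ∘ (z ∷ʳ_))
    with stable? n z L | stable? n z M
  ... | no ¬stable | _ =
    let a , a∈L , new = ¬stable⇒new ¬stable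
    in  a ℤ.+ z ∷ L , M , sumsetPair-∷ S a∈L new , cong suc size
  ... | yes _ | no ¬stable =
    let b , b∈M , new = ¬stable⇒new ¬stable
    in  L , b ℤ.+ z ∷ M , sumsetPair-swap (sumsetPair-∷ (sumsetPair-swap S) b∈M new)
        , trans (+-suc (length L) (length M)) (cong suc size)
  ... | yes stableˡ | yes stableʳ =
    contradiction (multiples-lift⇒∣ p∣n⇒p∣k (multiples-lift closed S stableˡ stableʳ)) n∤z

  zeroSumClosed⇒short : ∀ xs → All (λ x → ¬ + n ∣ℤ x) xs → ZeroSumClosed n (n * k) xs →
    2 + length xs ≤ 2 * n
  zeroSumClosed⇒short xs n∤xs closed =
    let L , M , S , size = largeSumsets xs n∤xs closed
    in  subst₂ _≤_ size (cong (_+_ n) (sym (+-identityʳ n)))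
          (+-mono-≤ (incongruent⇒length≤ (distinctˡ S)) (incongruent⇒length≤ (distinctʳ S)))

  η*-upper : η*-property n (n * k) (2 * n ∸ 1)
  η*-upper xs |xs|≡ n∤xs
    with dec-∃-⊆ (λ ys →
      (length ys ≤? n) ×-dec (+ n ∣ℤ? sumℤ ys) ×-dec ¬? (+ (n * k) ∣ℤ? sumℤ ys)) xs
  ... | yes (ys , ys⊆xs , |ys|≤n , n∣ , nk∤) =
    -- The empty sublist is ruled out because its sum 0 is divisible by `n * k`.
    ys , ys⊆xs , (λ { refl → nk∤ (ℤˢ.divides 0ℤ refl) }) , |ys|≤n , ∣⇒∣ᵤ n∣ , nk∤ ∘ ∣ᵤ⇒∣
  ... | no none =
    contradiction (zeroSumClosed⇒short xs (All.map (_∘ ∣⇒∣ᵤ) n∤xs) closed) (<⇒≱ (s≤s 2n≤1+|xs|))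
    where
    2n≤1+|xs| : 2 * n ≤ 1 + length xs
    2n≤1+|xs| = subst (λ l → 2 * n ≤ 1 + l) (sym |xs|≡) (m≤n+m∸n (2 * n) 1)
    -- The search covered only sublists of length at most n; `shorten` cuts a longer counterexample
    -- down to such a one.
    closed : ZeroSumClosed n (n * k) xs
    closed {ys} ys⊆xs n∣ = decidable-stable (+ (n * k) ∣ℤ? sumℤ ys) λ nk∤ →
      let zs , zs⊆ys , rest = shorten (length ys) ys ≤-refl n∣ nk∤
      in  none (zs , ⊆-trans zs⊆ys ys⊆xs , rest)

-- Carries the upper bound from η* to D*, and the lower bound and the infinite case from D* to η*.
η*⇒D* : ∀ n m {ℓ} → η*-property n m ℓ → D*-property n m ℓ
η*⇒D* _ _ η xs |xs|≡ n∤xs =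
  let ys , ys⊆xs , ys≢[] , _ , rest = η xs |xs|≡ n∤xs in ys , ys⊆xs , ys≢[] , rest

-- The infinite case and the lower bound

-- Here n = qp. Cancelling q leaves p ∣ ak, and as p does not divide k it divides a, which supplies
-- the missing factor.
prime-cancel : ∀ {p q a k} .{{_ : NonZero q}} → Prime p → ¬ p ∣ k →
  q * p ∣ a * (q * k) → q * p * k ∣ a * (q * k)
prime-cancel {p} {q} {a} {k} p-prime p∤k qp∣ = subst₂ _∣_ (sym (*-assoc q p k)) (sym swap)
  (*-monoʳ-∣ q (*-monoˡ-∣ k p∣a))
  where
  swap : a * (q * k) ≡ q * (a * k)
  swap = x∙yz≈y∙xz a q k
    where open import Algebra.Properties.CommutativeSemigroup *-commutativeSemigroup
  p∣a : p ∣ a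
  p∣a with euclidsLemma a k p-prime (*-cancelˡ-∣ q (subst (q * p ∣_) swap qp∣))
  ... | inj₁ p∣a = p∣a
  ... | inj₂ p∣k = contradiction p∣k p∤k

-- The witness is ℓ copies of (n / p) k.
D*-unattainable : ∀ {n k} .{{_ : NonZero n}} → ∃[ p ] (Prime p × p ∣ n × ¬ p ∣ k) →
  ∀ ℓ → ¬ D*-property n (n * k) ℓ
D*-unattainable {k = k} (p , p-prime , divides q refl , p∤k) ℓ D =
  let ys , ys⊆ , _ , n∣ , nk∤ = D (replicate ℓ x ++ []) |xs|≡ (All-++⁺ (replicate⁺ ℓ n∤x) [])
      a , ∣sum∣≡ = multiple ys⊆
  in  nk∤ (subst (q * p * k ∣_) (sym ∣sum∣≡)
        (prime-cancel {q = q} {a = a} p-prime p∤k (subst (q * p ∣_) ∣sum∣≡ n∣)))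
  where
  x = + (q * k)
  instance
    q≢0 : NonZero q
    q≢0 = m*n≢0⇒m≢0 q {p}
  n∤x : ¬ q * p ∣ q * k
  n∤x = p∤k ∘ *-cancelˡ-∣ q
  |xs|≡ : length (replicate ℓ x ++ []) ≡ ℓ
  |xs|≡ = trans (cong length (++-identityʳ (replicate ℓ x))) (length-replicate ℓ)
  multiple : ∀ {ys} → ys ⊆ replicate ℓ x ++ [] → ∃[ a ] (ℤ.∣ sumℤ ys ∣ ≡ a * (q * k))
  multiple ys⊆ with a , [] , _ , [] , sum≡ ← ⊆-replicate-++ ℓ x [] ys⊆ =
    a , trans (cong ℤ.∣_∣ (trans sum≡ (ℤₚ.+-identityʳ (+ a ℤ.* x)))) (ℤₚ.abs-* (+ a) x)

-- The witness consists of copies of 1 and −1, at most n − 1 of each.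
D*-lower : ∀ {n m ℓ} → 2 ≤ n → D*-property n m ℓ → 2 * n ∸ 1 ≤ ℓ
D*-lower {n@(suc n-1)} {m} {ℓ} 2≤n D = ≮⇒≥ λ ℓ<2n-1 →
  let ys , ys⊆ , _ , n∣ , m∤ = D xs |xs|≡ n∤xs
  in  m∤ (subst (m ∣_) (sym (n∣⇒∣sum∣≡0 (small ℓ<2n-1 ys⊆) n∣)) (m ∣0))
  where
  -- Copies of 1 are used first, up to n - 1 of them, and copies of -1 fill the rest, so the length
  -- is ℓ for every ℓ. The bound j ≤ n - 1 comes from ℓ < 2n - 1.
  i = n-1 ⊓ ℓ
  j = ℓ ∸ n-1
  xs = replicate i 1ℤ ++ replicate j -1ℤ ++ []
  |xs|≡ : length xs ≡ ℓ
  |xs|≡ = begin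
    length xs             ≡⟨ length-++ (replicate i 1ℤ) ⟩
    length (replicate i 1ℤ) + length (replicate j -1ℤ ++ [])
      ≡⟨ cong₂ _+_ (length-replicate i) (cong length (++-identityʳ (replicate j -1ℤ))) ⟩
    i + length (replicate j -1ℤ) ≡⟨ cong (_+_ i) (length-replicate j) ⟩
    i + j                 ≡⟨ m⊓n+n∸m≡n n-1 ℓ ⟩
    ℓ                     ∎
    where open ≡-Reasoning
  n∤xs : All (λ x → ¬ + n ℤᵘ.∣ x) xs
  n∤xs = All-++⁺ (replicate⁺ i (>⇒∤ 2≤n)) (All-++⁺ (replicate⁺ j (>⇒∤ 2≤n)) [])
  n∣⇒∣sum∣≡0 : ∀ {s} → s < n → n ∣ s → s ≡ 0
  n∣⇒∣sum∣≡0 {zero}  _   _   = refl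
  n∣⇒∣sum∣≡0 {suc _} s<n n∣s = contradiction n∣s (>⇒∤ s<n)
  -- A subsum is a - b with 0 ≤ a, b ≤ n - 1, so its absolute value is at most the maximum of a and
  -- b.
  small : ℓ < 2 * n ∸ 1 → ∀ {ys} → ys ⊆ xs → ℤ.∣ sumℤ ys ∣ < n
  small ℓ<2n-1 {ys} ys⊆
    with a , _ , a≤i , ws⊆ , sum≡ ← ⊆-replicate-++ i 1ℤ (replicate j -1ℤ ++ []) ys⊆
    with b , [] , b≤j , [] , sum≡′ ← ⊆-replicate-++ j -1ℤ [] ws⊆ = s≤s (begin
    ℤ.∣ sumℤ ys ∣     ≡⟨ cong ℤ.∣_∣ (trans sum≡ (cong (ℤ._+_ (+ a ℤ.* 1ℤ)) sum≡′)) ⟩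
    ℤ.∣ + a ℤ.* 1ℤ ℤ.+ (+ b ℤ.* -1ℤ ℤ.+ 0ℤ) ∣ ≡⟨ cong ℤ.∣_∣ (a-b (+ a) (+ b)) ⟩
    ℤ.∣ + a ℤ.- + b ∣ ≡⟨ cong ℤ.∣_∣ (ℤₚ.m-n≡m⊖n a b) ⟩
    ℤ.∣ a ℤ.⊖ b ∣     ≤⟨ ℤₚ.∣m⊝n∣≤m⊔n a b ⟩
    a ⊔ b             ≤⟨ ⊔-lub (≤-trans a≤i (m⊓n≤m n-1 ℓ)) (≤-trans b≤j j≤n-1) ⟩
    n-1               ∎)
    where
    open ≤-Reasoning
    a-b : ∀ a b → a ℤ.* 1ℤ ℤ.+ (b ℤ.* -1ℤ ℤ.+ 0ℤ) ≡ a ℤ.- b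
    a-b = solve-∀
    j≤n-1 : j ≤ n-1
    j≤n-1 = m≤n+o⇒m∸n≤o ℓ n-1 (s≤s⁻¹ (subst (ℓ <_) 2n-1≡ ℓ<2n-1))
      where
      2n-1≡ : n-1 + (n + 0) ≡ suc (n-1 + n-1)
      2n-1≡ = trans (cong (_+_ n-1) (+-identityʳ n)) (+-suc n-1 n-1)

theorem1p2 : (n k : ℕ) → 2 ≤ n → 2 ≤ k →
    (¬ (rad n ∣ rad k) →
    (D*⟨ n , n * k ⟩≔ ∞) × (η*⟨ n , n * k ⟩≔ ∞))
    × (rad n ∣ rad k →
    (D*⟨ n , n * k ⟩≔ [ 2 * n ∸ 1 ]) × (η*⟨ n , n * k ⟩≔ [ 2 * n ∸ 1 ]))
theorem1p2 n k 2≤n 2≤k = infinite , finite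
  where
  instance
    n≢0 : NonZero n
    n≢0 = >-nonZero (<⇒≤ 2≤n)
    k≢0 : NonZero k
    k≢0 = >-nonZero (<⇒≤ 2≤k)
  infinite : ¬ (rad n ∣ rad k) → (D*⟨ n , n * k ⟩≔ ∞) × (η*⟨ n , n * k ⟩≔ ∞)
  infinite rad∤ = (λ ℓ _ → unattainable ℓ) , (λ ℓ _ η → unattainable ℓ (η*⇒D* n (n * k) η))
    where unattainable = D*-unattainable (rad∤rad⇒prime n k rad∤)
  finite : rad n ∣ rad k → (D*⟨ n , n * k ⟩≔ [ 2 * n ∸ 1 ]) × (η*⟨ n , n * k ⟩≔ [ 2 * n ∸ 1 ])
  finite rad∣ = (1≤2n-1 , η*⇒D* n (n * k) upper , λ ℓ _ D → D*-lower 2≤n D)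
              , (1≤2n-1 , upper , λ ℓ _ η → D*-lower 2≤n (η*⇒D* n (n * k) η))
    where
    upper : η*-property n (n * k) (2 * n ∸ 1)
    upper = η*-upper (rad∣rad⇒prime∣ rad∣)
    1≤2n-1 : 1 ≤ 2 * n ∸ 1
    1≤2n-1 = ∸-monoˡ-≤ 1 (≤-trans 2≤n (m≤m+n n _))
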